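{- For every positive integer $n$, let $D_n$ be the digraph with vertex set $K(D_n)\cup I(D_n)$, where \[ K(D_n) = \{k_0,\ldots,k_{2n}\},\qquad I(D_n)=\{s_{ij}\colon 0\leq i\leq 2n,\ 1\leq j\leq n\}, \] (all these vertices being distinct) and with arc set \[ A(D_n)=\{(k_i,k_{i+j})\colon 0\leq i\leq 2n,\ 1\leq j\leq n\}\cup\{(s_{ij},k_i)\colon 0\leq i\leq 2n,\ 1\leq j\leq n\}, \] where the sum $i+j$ in the index of $k_{i+j}$ is taken modulo $2n+1$. Denote by $Q_n$ a smallest quasi-kernel of $D_n$. Then \[ \lim_{n\to+\infty}\frac{|Q_n|}{|V(D_n)|}=\frac{1}{2}. \]
   Context: A quasi-kernel of a digraph $D$ is an independent set $Q\subseteq V(D)$ (no arc between any two vertices of $Q$) such that from every vertex of $D$ there is a directed path of length at most two to some vertex of $Q$ (length zero for vertices of $Q$). Every finite digraph has a quasi-kernel, so a smallest one (a quasi-kernel of minimum cardinality) exists. -}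

module Defs where

open import Data.Fin.Base using (Fin; toℕ)
open import Data.Fin.Properties using (+↔⊎; *↔×)
open import Data.Fin.Subset as Subset using (Subset)
open import Data.Integer.Base using (+_)
open import Data.List.Base using (List; []; _∷_)
open import Data.List.Relation.Unary.Unique.Propositional using (Unique)
open import Data.Nat.Base as ℕ using (ℕ; suc; NonZero)
open import Data.Nat.DivMod using (_%_)
open import Data.Product.Base using (_×_; _,_; ∃-syntax)
open import Data.Rational.Base as ℚ using (ℚ; 0ℚ)
open import Data.Sum.Base using (_⊎_; inj₁; inj₂)
open import Data.Sum.Function.Propositional using (_⊎-↔_)
open import Function.Bundles using (_↔_; mk↔ₛ′; Inverse)
open import Function.Construct.Composition using (_↔-∘_)
open import Function.Construct.Identity using (↔-id)
open import Function.Construct.Symmetry using (↔-sym)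
open import Relation.Binary.Construct.Closure.ReflexiveTransitive using (Star; ε; _◅_)
open import Relation.Binary.PropositionalEquality using (_≡_; refl)
open import Relation.Nullary.Negation using (¬_)

record Digraph : Set₁ where
  field
    Vertex : Set
    Arc    : Vertex → Vertex → Set
    order  : ℕ
    finite : Vertex ↔ Fin order

module _ (D : Digraph) where
  open Digraph D

  -- Vertex sets are subsets of Fin order, read through the enumeration
  -- `finite`; the cardinality is then that of Data.Fin.Subset.
  VertexSet : Set
  VertexSet = Subset order

  infix 4 _∈V_

  _∈V_ : Vertex → VertexSet → Set
  v ∈V Q = Inverse.to finite v Subset.∈ Q

  Walk : Vertex → Vertex → Set
  Walk = Star Arc

  length : ∀ {u v} → Walk u v → ℕ
  length ε       = 0
  length (_ ◅ w) = suc (length w)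

  vertices : ∀ {u v} → Walk u v → List Vertex
  vertices {u} ε       = u ∷ []
  vertices {u} (_ ◅ w) = u ∷ vertices w

  record Path (u v : Vertex) : Set where
    field
      walk     : Walk u v
      distinct : Unique (vertices walk)

  IsIndependent : VertexSet → Set
  IsIndependent Q = ∀ u v → u ∈V Q → v ∈V Q → ¬ Arc u v

  record IsQuasiKernel (Q : VertexSet) : Set where
    field
      independent : IsIndependent Q
      absorbing   : ∀ u → ∃[ v ] v ∈V Q × ∃[ p ] length (Path.walk {u} {v} p) ℕ.≤ 2

  IsSmallestQuasiKernel : VertexSet → Set
  IsSmallestQuasiKernel Q =
    IsQuasiKernel Q × (∀ Q′ → IsQuasiKernel Q′ → Subset.∣ Q ∣ ℕ.≤ Subset.∣ Q′ ∣)

-- s i j stands for the vertex with second index 1 + toℕ j, so that the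
-- second index ranges over 1, …, n.
data DVertex (n : ℕ) : Set where
  k : Fin (suc (2 ℕ.* n)) → DVertex n
  s : Fin (suc (2 ℕ.* n)) → Fin n → DVertex n

data DArc (n : ℕ) : DVertex n → DVertex n → Set where
  k→k : ∀ i j i′ → 1 ℕ.≤ j → j ℕ.≤ n →
        toℕ i′ ≡ (toℕ i ℕ.+ j) % suc (2 ℕ.* n) → DArc n (k i) (k i′)
  s→k : ∀ i j → DArc n (s i j) (k i)

DVertex↔⊎ : ∀ n → DVertex n ↔ (Fin (suc (2 ℕ.* n)) ⊎ (Fin (suc (2 ℕ.* n)) × Fin n))
DVertex↔⊎ n = mk↔ₛ′ to from to∘from from∘to
  where
  to : DVertex n → Fin (suc (2 ℕ.* n)) ⊎ (Fin (suc (2 ℕ.* n)) × Fin n)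
  to (k i)   = inj₁ i
  to (s i j) = inj₂ (i , j)

  from : Fin (suc (2 ℕ.* n)) ⊎ (Fin (suc (2 ℕ.* n)) × Fin n) → DVertex n
  from (inj₁ i)       = k i
  from (inj₂ (i , j)) = s i j

  to∘from : ∀ x → to (from x) ≡ x
  to∘from (inj₁ _) = refl
  to∘from (inj₂ _) = refl

  from∘to : ∀ x → from (to x) ≡ x
  from∘to (k _)   = refl
  from∘to (s _ _) = refl

D : ℕ → Digraph
D n = record
  { Vertex = DVertex n
  ; Arc    = DArc n
  ; order  = suc (2 ℕ.* n) ℕ.+ suc (2 ℕ.* n) ℕ.* n
  ; finite = ↔-sym +↔⊎ ↔-∘ ((↔-id _ ⊎-↔ ↔-sym *↔×) ↔-∘ DVertex↔⊎ n)
  }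

ratio : ∀ n → VertexSet (D n) → ℚ
ratio n Q = + Subset.∣ Q ∣ ℚ./ Digraph.order (D n)

-- Convergence of a rational sequence indexed by the positive integers to
-- a rational limit. Rational ε suffice, the rationals being dense in ℝ.
ConvergesTo : ((n : ℕ) → .{{NonZero n}} → ℚ) → ℚ → Set
ConvergesTo a L =
  ∀ ε → 0ℚ ℚ.< ε → ∃[ N ] (∀ n → .{{_ : NonZero n}} → N ℕ.≤ n → ℚ.∣ a n ℚ.- L ∣ ℚ.< ε)

{-# OPTIONS --safe #-}
-- The vertices k_i induce a tournament in which every vertex has exactly n
-- out-neighbours, so a quasi-kernel Q contains at most one of them. If k_a ∈ Q,
-- then s_{ij} is absorbed within two steps unless k_i is an out-neighbour of
-- k_a; for those n values of i all n vertices s_{ij} lie in Q. If Q contains no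
-- k_a, it contains every s_{ij}. Hence |Q| ≥ n². Conversely k_0 together with
-- the s_{ij} for 1 ≤ i, j ≤ n is a quasi-kernel of size 1 + n². As
-- |V| = (2n + 1)(n + 1), the ratio differs from ½ by less than 1/n.
module Submission where

open import Defs
open import Data.Fin.Base using (Fin; zero; suc; toℕ; fromℕ<; _↑ˡ_; _↑ʳ_; splitAt; remQuot; combine)
open import Data.Fin.Properties
  using (toℕ-fromℕ<; toℕ<n; toℕ-injective; toℕ-↑ˡ; toℕ-↑ʳ; splitAt⁻¹-↑ˡ; splitAt⁻¹-↑ʳ;
         combine-remQuot; remQuot-combine; any?)
open import Data.Fin.Subset using (Subset; inside; outside; ⊥; ⁅_⁆; _∪_; _-_; _∈_; ∣_∣)
open import Data.Fin.Subset.Properties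
  using (∉⊥; ∣⊥∣≡0; ∣⁅x⁆∣≡1; x∈⁅x⁆; x∈⁅y⁆⇒x≡y; x∈p∪q⁻; x∈p∪q⁺; x∈p∧x≢y⇒x∈p-y; x∈p⇒∣p-x∣<∣p∣; _∈?_)
open import Data.Integer.Base as ℤ using (+_; -[1+_]; _⊖_; +<+)
import Data.Integer.Properties as ℤ
open import Data.List.Relation.Unary.All using ([]; _∷_)
open import Data.List.Relation.Unary.Unique.Propositional using ([]; _∷_)
open import Data.Nat.Base using (ℕ; zero; suc; NonZero; _+_; _*_; _∸_; _≤_; _<_; z≤n; s≤s)
open import Data.Nat.DivMod using (_%_; m%n<n; m%n%n≡m%n; m<n⇒m%n≡m; n%n≡0; [m+n]%n≡m%n; %-distribˡ-+)
open import Data.Nat.Properties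
open import Data.Nat.Tactic.RingSolver using (solve-∀)
open import Data.Product.Base using (_×_; _,_; ∃-syntax; proj₁; proj₂; uncurry)
open import Data.Rational.Base as ℚ using (½; mkℚ; toℚᵘ)
open import Data.Rational.Properties
  using (toℚᵘ-homo-∣-∣; toℚᵘ-homo-+; toℚᵘ-fromℚᵘ; toℚᵘ-cancel-<)
open import Data.Rational.Unnormalised.Base as ℚᵘ using (mkℚᵘ)
import Data.Rational.Unnormalised.Properties as ℚᵘ
open import Data.Sum.Base using (_⊎_; inj₁; inj₂)
open import Data.Vec.Base using ([]; _∷_)
open import Function.Base using (_∘_)
open import Function.Bundles using (Inverse; Injection)
open import Function.Definitions using (Injective)
open import Function.Properties.Inverse using (↔⇒↣)
open import Relation.Binary.Construct.Closure.ReflexiveTransitive using (ε; _◅_)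
open import Relation.Binary.PropositionalEquality
  using (_≡_; _≢_; refl; sym; trans; cong; cong₂; subst; subst₂; module ≡-Reasoning)
open import Relation.Nullary.Decidable using (yes; no)
open import Relation.Nullary.Negation using (¬_; contradiction)

-- Cardinalities of subsets and images.

∣p∪q∣≤∣p∣+∣q∣ : ∀ {n} (p q : Subset n) → ∣ p ∪ q ∣ ≤ ∣ p ∣ + ∣ q ∣
∣p∪q∣≤∣p∣+∣q∣ []            []            = z≤n
∣p∪q∣≤∣p∣+∣q∣ (outside ∷ p) (outside ∷ q) = ∣p∪q∣≤∣p∣+∣q∣ p q
∣p∪q∣≤∣p∣+∣q∣ (outside ∷ p) (inside  ∷ q) =
  ≤-trans (s≤s (∣p∪q∣≤∣p∣+∣q∣ p q)) (≤-reflexive (sym (+-suc ∣ p ∣ ∣ q ∣)))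
∣p∪q∣≤∣p∣+∣q∣ (inside  ∷ p) (outside ∷ q) = s≤s (∣p∪q∣≤∣p∣+∣q∣ p q)
∣p∪q∣≤∣p∣+∣q∣ (inside  ∷ p) (inside  ∷ q) =
  s≤s (≤-trans (∣p∪q∣≤∣p∣+∣q∣ p q) (+-monoʳ-≤ ∣ p ∣ (n≤1+n ∣ q ∣)))

image : ∀ {m n} → (Fin m → Fin n) → Subset n
image {zero}  f = ⊥
image {suc m} f = ⁅ f zero ⁆ ∪ image (f ∘ suc)

∈-image⁺ : ∀ {m n} (f : Fin m → Fin n) i → f i ∈ image f
∈-image⁺ f zero    = x∈p∪q⁺ (inj₁ (x∈⁅x⁆ (f zero)))
∈-image⁺ f (suc i) = x∈p∪q⁺ (inj₂ (∈-image⁺ (f ∘ suc) i))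

∈-image⁻ : ∀ {m n} (f : Fin m → Fin n) {x} → x ∈ image f → ∃[ i ] x ≡ f i
∈-image⁻ {zero}  f x∈ = contradiction x∈ ∉⊥
∈-image⁻ {suc m} f x∈ with x∈p∪q⁻ ⁅ f zero ⁆ (image (f ∘ suc)) x∈
... | inj₁ x∈₁ = zero , x∈⁅y⁆⇒x≡y (f zero) x∈₁
... | inj₂ x∈₂ with i , eq ← ∈-image⁻ (f ∘ suc) x∈₂ = suc i , eq

∣image∣≤ : ∀ {m n} (f : Fin m → Fin n) → ∣ image f ∣ ≤ m
∣image∣≤ {zero}  {n} f = ≤-reflexive (∣⊥∣≡0 n)
∣image∣≤ {suc m} {n} f = ≤-trans (∣p∪q∣≤∣p∣+∣q∣ ⁅ f zero ⁆ (image (f ∘ suc)))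
  (+-mono-≤ (≤-reflexive (∣⁅x⁆∣≡1 (f zero))) (∣image∣≤ (f ∘ suc)))

-- Removing `f zero` from `p` lowers the cardinality, and by injectivity the other values of `f`
-- stay in `p - f zero`, so induction on `m` applies.
injective⇒≤∣∣ : ∀ {m n} (f : Fin m → Fin n) {p : Subset n} →
                Injective _≡_ _≡_ f → (∀ i → f i ∈ p) → m ≤ ∣ p ∣
injective⇒≤∣∣ {zero}  f     inj f∈p = z≤n
injective⇒≤∣∣ {suc m} f {p} inj f∈p = ≤-trans (s≤s rest) (x∈p⇒∣p-x∣<∣p∣ (f∈p zero))
  where
  f∘suc≢f0 : ∀ i → f (suc i) ≢ f zero
  f∘suc≢f0 i eq with () ← inj eq

  suc-inj : Injective _≡_ _≡_ (f ∘ suc)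
  suc-inj eq with refl ← inj eq = refl

  rest : m ≤ ∣ p - f zero ∣
  rest = injective⇒≤∣∣ (f ∘ suc) suc-inj (λ i → x∈p∧x≢y⇒x∈p-y (f∈p (suc i)) (f∘suc≢f0 i))

-- Arithmetic modulo 2n + 1 and the tournament on the `k i`.

[m%d+n]%d≡[m+n]%d : ∀ m n d .{{_ : NonZero d}} → (m % d + n) % d ≡ (m + n) % d
[m%d+n]%d≡[m+n]%d m n d = begin
  (m % d + n) % d         ≡⟨ %-distribˡ-+ (m % d) n d ⟩
  (m % d % d + n % d) % d ≡⟨ cong (λ x → (x + n % d) % d) (m%n%n≡m%n m d) ⟩
  (m % d + n % d) % d     ≡⟨ %-distribˡ-+ m n d ⟨
  (m + n) % d             ∎
  where open ≡-Reasoning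

module _ (n : ℕ) where

  private
    m : ℕ
    m = suc (2 * n)

  index : DVertex n → Fin (Digraph.order (D n))
  index = Inverse.to (Digraph.finite (D n))

  index-injective : Injective _≡_ _≡_ index
  index-injective = Injection.injective (↔⇒↣ (Digraph.finite (D n)))

  toℕ%≡toℕ : ∀ (a : Fin m) → toℕ a % m ≡ toℕ a
  toℕ%≡toℕ a = m<n⇒m%n≡m (toℕ<n a)

  -- The two offsets add up to at most 2n. If the sum is at most n, it is the offset of an arc from
  -- `k a` to `k b`; otherwise its complement to 2n + 1 lies between 1 and n and leads from `k b`
  -- back to `k a`.
  two-steps⇒adjacent : ∀ {a i b} → DArc n (k a) (k i) → DArc n (k i) (k b) →
                       DArc n (k a) (k b) ⊎ DArc n (k b) (k a)
  two-steps⇒adjacent {a} {i} {b} (k→k _ j₁ _ 1≤j₁ j₁≤n eq₁) (k→k _ j₂ _ 1≤j₂ j₂≤n eq₂)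
    with j₁ + j₂ ≤? n
  ... | yes j≤n = inj₁ (k→k a (j₁ + j₂) b (≤-trans 1≤j₁ (m≤m+n j₁ j₂)) j≤n b≡)
    where
    b≡ : toℕ b ≡ (toℕ a + (j₁ + j₂)) % m
    b≡ = trans eq₂ (trans (cong (λ x → (x + j₂) % m) eq₁)
          (trans ([m%d+n]%d≡[m+n]%d (toℕ a + j₁) j₂ m) (cong (_% m) (+-assoc (toℕ a) j₁ j₂))))
  ... | no j≰n = inj₂ (k→k b (m ∸ (j₁ + j₂)) a (m<n⇒0<n∸m (s≤s j≤2n))
                        (m≤n+o⇒m∸n≤o m (j₁ + j₂) m≤j+n) a≡)
    where
    j≤2n : j₁ + j₂ ≤ 2 * n
    j≤2n = +-mono-≤ j₁≤n (≤-trans j₂≤n (m≤m+n n 0))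

    m≤j+n : m ≤ j₁ + j₂ + n
    m≤j+n = subst (λ x → suc (n + x) ≤ j₁ + j₂ + n) (sym (+-identityʳ n))
              (+-monoˡ-≤ n (≰⇒> j≰n))

    open ≡-Reasoning
    a≡ : toℕ a ≡ (toℕ b + (m ∸ (j₁ + j₂))) % m
    -- A full turn `m` is added to `a` and split into `j₁` and `j₂`, which lead to `b`, and the
    -- remaining offset.
    a≡ = begin
      toℕ a
        ≡⟨ toℕ%≡toℕ a ⟨
      toℕ a % m
        ≡⟨ [m+n]%n≡m%n (toℕ a) m ⟨
      (toℕ a + m) % m
        ≡⟨ cong (λ x → (toℕ a + x) % m) (m+[n∸m]≡n (m≤n⇒m≤1+n j≤2n)) ⟨
      (toℕ a + (j₁ + j₂ + (m ∸ (j₁ + j₂)))) % m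
        ≡⟨ cong (_% m) (trans (sym (+-assoc (toℕ a) (j₁ + j₂) _))
             (cong (_+ (m ∸ (j₁ + j₂))) (sym (+-assoc (toℕ a) j₁ j₂)))) ⟩
      (toℕ a + j₁ + j₂ + (m ∸ (j₁ + j₂))) % m
        ≡⟨ [m%d+n]%d≡[m+n]%d (toℕ a + j₁ + j₂) _ m ⟨
      ((toℕ a + j₁ + j₂) % m + (m ∸ (j₁ + j₂))) % m
        ≡⟨ cong (λ x → (x + (m ∸ (j₁ + j₂))) % m) ([m%d+n]%d≡[m+n]%d (toℕ a + j₁) j₂ m) ⟨
      (((toℕ a + j₁) % m + j₂) % m + (m ∸ (j₁ + j₂))) % m
        ≡⟨ cong (λ x → ((x + j₂) % m + (m ∸ (j₁ + j₂))) % m) eq₁ ⟨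
      ((toℕ i + j₂) % m + (m ∸ (j₁ + j₂))) % m
        ≡⟨ cong (λ x → (x + (m ∸ (j₁ + j₂))) % m) eq₂ ⟨
      (toℕ b + (m ∸ (j₁ + j₂))) % m
        ∎

  out : Fin m → Fin n → Fin m
  out a i = fromℕ< (m%n<n (toℕ a + suc (toℕ i)) m)

  toℕ-out : ∀ a i → toℕ (out a i) ≡ (toℕ a + suc (toℕ i)) % m
  toℕ-out a i = toℕ-fromℕ< (m%n<n (toℕ a + suc (toℕ i)) m)

  arc-out : ∀ a i → DArc n (k a) (k (out a i))
  arc-out a i = k→k a (suc (toℕ i)) (out a i) (s≤s z≤n) (toℕ<n i) (toℕ-out a i)

  -- Adding `m ∸ toℕ a` undoes the shift by `a` modulo `m`; the offset, being at most n, is its own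
  -- residue and is recovered.
  out-injective : ∀ a → Injective _≡_ _≡_ (out a)
  out-injective a {i} {i′} eq =
    toℕ-injective (suc-injective (trans (sym (recover i))
      (trans (cong (λ x → (toℕ x + (m ∸ toℕ a)) % m) eq) (recover i′))))
    where
    open ≡-Reasoning
    recover : ∀ i → (toℕ (out a i) + (m ∸ toℕ a)) % m ≡ suc (toℕ i)
    recover i = begin
      (toℕ (out a i) + (m ∸ toℕ a)) % m
        ≡⟨ cong (λ x → (x + (m ∸ toℕ a)) % m) (toℕ-out a i) ⟩
      ((toℕ a + suc (toℕ i)) % m + (m ∸ toℕ a)) % m
        ≡⟨ [m%d+n]%d≡[m+n]%d (toℕ a + suc (toℕ i)) _ m ⟩
      (toℕ a + suc (toℕ i) + (m ∸ toℕ a)) % m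
        ≡⟨ cong (λ x → (x + (m ∸ toℕ a)) % m) (+-comm (toℕ a) (suc (toℕ i))) ⟩
      (suc (toℕ i) + toℕ a + (m ∸ toℕ a)) % m
        ≡⟨ cong (_% m) (+-assoc (suc (toℕ i)) (toℕ a) _) ⟩
      (suc (toℕ i) + (toℕ a + (m ∸ toℕ a))) % m
        ≡⟨ cong (λ x → (suc (toℕ i) + x) % m) (m+[n∸m]≡n (<⇒≤ (toℕ<n a))) ⟩
      (suc (toℕ i) + m) % m
        ≡⟨ [m+n]%n≡m%n (suc (toℕ i)) m ⟩
      suc (toℕ i) % m
        ≡⟨ m<n⇒m%n≡m (s≤s (≤-trans (toℕ<n i) (m≤m+n n _))) ⟩
      suc (toℕ i)
        ∎

  -- The lower bound n² for every quasi-kernel.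

  module _ {Q : VertexSet (D n)} (qk : IsQuasiKernel (D n) Q) where
    open IsQuasiKernel qk

    private
      infix 4 _∈Q
      _∈Q : DVertex n → Set
      v ∈Q = _∈V_ (D n) v Q

    -- The only arc out of `s i j` leads to `k i`. A non-empty walk of length at most two thus ends
    -- at `k i` or at an out-neighbour of `k i`; either is adjacent to `k a`, against independence.
    out-neighbour⇒s∈Q : ∀ {a i} → k a ∈Q → DArc n (k a) (k i) → ∀ j → s i j ∈Q
    out-neighbour⇒s∈Q {a} {i} ka∈Q a→i j with absorbing (s i j)
    ... | _ , v∈Q , p , len = go (Path.walk p) len v∈Q
      where
      go : ∀ {v} (w : Walk (D n) (s i j) v) → length (D n) w ≤ 2 → v ∈Q → s i j ∈Q
      go ε _ v∈Q = v∈Q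
      go (s→k _ _ ◅ ε) _ v∈Q = contradiction a→i (independent _ _ ka∈Q v∈Q)
      go (s→k _ _ ◅ i→b@(k→k _ _ _ _ _ _) ◅ ε) _ v∈Q with two-steps⇒adjacent a→i i→b
      ... | inj₁ a→b = contradiction a→b (independent _ _ ka∈Q v∈Q)
      ... | inj₂ b→a = contradiction b→a (independent _ _ v∈Q ka∈Q)
      go (_ ◅ _ ◅ _ ◅ _) (s≤s (s≤s ())) _

    -- Arcs only enter vertices `k a`, so no walk that has left `s i j` ends at an `s`; the
    -- absorbing walk must be empty.
    no-k⇒s∈Q : (∀ a → ¬ k a ∈Q) → ∀ i j → s i j ∈Q
    no-k⇒s∈Q k∉Q i j with absorbing (s i j)
    ... | k a   , v∈Q , _ = contradiction v∈Q (k∉Q a)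
    ... | s _ _ , v∈Q , p , _ = go (Path.walk p) v∈Q
      where
      s-unreachable : ∀ {a i′ j′} → ¬ Walk (D n) (k a) (s i′ j′)
      s-unreachable (k→k _ _ _ _ _ _ ◅ w) = s-unreachable w

      go : ∀ {i′ j′} → Walk (D n) (s i j) (s i′ j′) → s i′ j′ ∈Q → s i j ∈Q
      go ε v∈Q = v∈Q
      go (s→k _ _ ◅ w) _ = contradiction w s-unreachable

    full-rows⇒n*n≤∣Q∣ : (f : Fin n → Fin m) → Injective _≡_ _≡_ f →
                        (∀ i j → s (f i) j ∈Q) → n * n ≤ ∣ Q ∣
    full-rows⇒n*n≤∣Q∣ f f-inj s∈Q =
      injective⇒≤∣∣ (index ∘ g ∘ remQuot n) inj (λ x → uncurry s∈Q (remQuot n x))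
      where
      g : Fin n × Fin n → DVertex n
      g (i , j) = s (f i) j

      g-inj : ∀ {x y} → g x ≡ g y → x ≡ y
      g-inj {i , j} {i′ , j′} eq = cong₂ _,_ (f-inj (row eq)) (column eq)
        where
        row : ∀ {a b j j′} → s a j ≡ s b j′ → a ≡ b
        row refl = refl

        column : ∀ {a b : Fin m} {j j′ : Fin n} → s a j ≡ s b j′ → j ≡ j′
        column refl = refl

      inj : Injective _≡_ _≡_ (index ∘ g ∘ remQuot n)
      inj {x} {y} eq = trans (sym (combine-remQuot {n} n x))
        (trans (cong (uncurry combine) (g-inj (index-injective eq))) (combine-remQuot {n} n y))

    n*n≤∣Q∣ : n * n ≤ ∣ Q ∣
    n*n≤∣Q∣ with any? (λ a → index (k a) ∈? Q)
    ... | yes (a , ka∈Q) = full-rows⇒n*n≤∣Q∣ (out a) (out-injective a)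
            (λ i → out-neighbour⇒s∈Q ka∈Q (arc-out a i))
    -- All rows are full here, so any injection of `Fin n` into the row indices serves; `out zero`
    -- is one.
    ... | no  k∉Q        = full-rows⇒n*n≤∣Q∣ (out zero) (out-injective zero)
            (λ i → no-k⇒s∈Q (λ a ka∈Q → k∉Q (a , ka∈Q)) (out zero i))

  -- A quasi-kernel with at most n² + 1 vertices.

  Q₀-vertex : Fin (suc (n * n)) → DVertex n
  Q₀-vertex zero    = k zero
  -- As `2 * n` unfolds to `n + (n + 0)`, the row index ranges over 1, ..., n: the out-neighbours of
  -- `k zero`, whose rows are forced by `out-neighbour⇒s∈Q`.
  Q₀-vertex (suc x) = s (suc (proj₁ (remQuot {n} n x) ↑ˡ (n + 0))) (proj₂ (remQuot {n} n x))

  Q₀ : VertexSet (D n)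
  Q₀ = image (index ∘ Q₀-vertex)

  k0∈Q₀ : index (k zero) ∈ Q₀
  k0∈Q₀ = ∈-image⁺ (index ∘ Q₀-vertex) zero

  s∈Q₀ : ∀ i j → index (s (suc (i ↑ˡ (n + 0))) j) ∈ Q₀
  s∈Q₀ i j = subst (λ x → index (s (suc (proj₁ x ↑ˡ (n + 0))) (proj₂ x)) ∈ Q₀)
               (remQuot-combine {n} i j) (∈-image⁺ (index ∘ Q₀-vertex) (suc (combine i j)))

  Q₀-independent : IsIndependent (D n) Q₀
  Q₀-independent u v u∈ v∈ arc with ∈-image⁻ (index ∘ Q₀-vertex) u∈ | ∈-image⁻ (index ∘ Q₀-vertex) v∈
  ... | x , eq₁ | y , eq₂
    with refl ← index-injective {u} {Q₀-vertex x} eq₁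
       | refl ← index-injective {v} {Q₀-vertex y} eq₂ = no-arc x y arc
    where
    no-arc : ∀ x y → ¬ DArc n (Q₀-vertex x) (Q₀-vertex y)
    -- Only a loop at `k zero` has to be refuted: no arc enters an `s`, and the rows in `Q₀` have
    -- non-zero index, so none has an arc to `k zero`.
    no-arc zero zero (k→k _ j _ 1≤j j≤n eq) =
      contradiction (trans eq (m<n⇒m%n≡m (s≤s (≤-trans j≤n (m≤m+n n _))))) (<⇒≢ 1≤j)

  -- The indices n + 1, ..., 2n are those whose distance n - y to the full turn is at most n.
  arc-to-k0 : ∀ y → DArc n (k (suc (n ↑ʳ y))) (k zero)
  arc-to-k0 y = k→k _ (n ∸ toℕ y) zero (m<n⇒0<n∸m y<n) (m∸n≤m n (toℕ y)) (sym wrap)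
    where
    y<n : toℕ y < n
    y<n = subst (toℕ y <_) (+-identityʳ n) (toℕ<n y)

    open ≡-Reasoning
    wrap : (suc (toℕ (n ↑ʳ y)) + (n ∸ toℕ y)) % m ≡ 0
    wrap = begin
      (suc (toℕ (n ↑ʳ y)) + (n ∸ toℕ y)) % m ≡⟨ cong (λ x → (suc x + (n ∸ toℕ y)) % m) (toℕ-↑ʳ n y) ⟩
      suc (n + toℕ y + (n ∸ toℕ y)) % m      ≡⟨ cong (λ x → suc x % m) (+-assoc n (toℕ y) _) ⟩
      suc (n + (toℕ y + (n ∸ toℕ y))) % m    ≡⟨ cong (λ x → suc (n + x) % m) (m+[n∸m]≡n (<⇒≤ y<n)) ⟩
      suc (n + n) % m                        ≡⟨ cong (λ x → suc (n + x) % m) (+-identityʳ n) ⟨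
      m % m                                  ≡⟨ n%n≡0 m ⟩
      0                                      ∎

  arc-shift-n : ∀ i → DArc n (k (suc (i ↑ˡ (n + 0)))) (k (suc (n ↑ʳ (i ↑ˡ 0))))
  arc-shift-n i = k→k _ n _ (≤-trans (s≤s z≤n) (toℕ<n i)) ≤-refl (sym shift)
    where
    open ≡-Reasoning
    shift : (suc (toℕ (i ↑ˡ (n + 0))) + n) % m ≡ suc (toℕ (n ↑ʳ (i ↑ˡ 0)))
    shift = begin
      (suc (toℕ (i ↑ˡ (n + 0))) + n) % m ≡⟨ cong (λ x → (suc x + n) % m) (trans (toℕ-↑ˡ i (n + 0)) (sym (toℕ-↑ˡ i 0))) ⟩
      suc (toℕ (i ↑ˡ 0) + n) % m         ≡⟨ cong (λ x → suc x % m) (+-comm (toℕ (i ↑ˡ 0)) n) ⟩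
      suc (n + toℕ (i ↑ˡ 0)) % m         ≡⟨ cong (λ x → suc x % m) (toℕ-↑ʳ n (i ↑ˡ 0)) ⟨
      toℕ (suc (n ↑ʳ (i ↑ˡ 0))) % m      ≡⟨ toℕ%≡toℕ (suc (n ↑ʳ (i ↑ˡ 0))) ⟩
      suc (toℕ (n ↑ʳ (i ↑ˡ 0)))          ∎

  ↑ˡ≢↑ʳ : ∀ (i : Fin n) (y : Fin (n + 0)) → i ↑ˡ (n + 0) ≢ n ↑ʳ y
  ↑ˡ≢↑ʳ i y eq = <⇒≢ (<-≤-trans (toℕ<n i) (m≤m+n n (toℕ y)))
    (trans (sym (toℕ-↑ˡ i (n + 0))) (trans (cong toℕ eq) (toℕ-↑ʳ n y)))

  -- Indices split into 0, the range 1, ..., n and the range n + 1, ..., 2n. The last has arcs to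
  -- `k zero`, and a step of n leads from the middle range into it. Rows of the middle range lie in
  -- `Q₀`; other rows reach `k zero` through their own `k`.
  Q₀-absorbing : ∀ u → ∃[ v ] index v ∈ Q₀ × ∃[ p ] length (D n) (Path.walk {D n} {u} {v} p) ≤ 2
  Q₀-absorbing (k zero) = k zero , k0∈Q₀ , record { walk = ε ; distinct = [] ∷ [] } , z≤n
  Q₀-absorbing (k (suc x)) with splitAt n x in eq
  ... | inj₁ i with refl ← splitAt⁻¹-↑ˡ {n} eq = k zero , k0∈Q₀ , record
    { walk     = arc-shift-n i ◅ arc-to-k0 (i ↑ˡ 0) ◅ ε
    ; distinct = ((λ { eq′ → ↑ˡ≢↑ʳ i (i ↑ˡ 0) (k-suc eq′) }) ∷ (λ ()) ∷ []) ∷ ((λ ()) ∷ []) ∷ [] ∷ []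
    } , ≤-refl
    where
    k-suc : ∀ {a b : Fin (2 * n)} → k {n} (suc a) ≡ k (suc b) → a ≡ b
    k-suc refl = refl
  ... | inj₂ y with refl ← splitAt⁻¹-↑ʳ {n} eq = k zero , k0∈Q₀ , record
    { walk     = arc-to-k0 y ◅ ε
    ; distinct = ((λ ()) ∷ []) ∷ [] ∷ []
    } , s≤s z≤n
  Q₀-absorbing (s zero j) = k zero , k0∈Q₀ , record
    { walk     = s→k zero j ◅ ε
    ; distinct = ((λ ()) ∷ []) ∷ [] ∷ []
    } , s≤s z≤n
  Q₀-absorbing (s (suc x) j) with splitAt n x in eq
  ... | inj₁ i with refl ← splitAt⁻¹-↑ˡ {n} eq =
    s _ j , s∈Q₀ i j , record { walk = ε ; distinct = [] ∷ [] } , z≤n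
  ... | inj₂ y with refl ← splitAt⁻¹-↑ʳ {n} eq = k zero , k0∈Q₀ , record
    { walk     = s→k _ j ◅ arc-to-k0 y ◅ ε
    ; distinct = ((λ ()) ∷ (λ ()) ∷ []) ∷ ((λ ()) ∷ []) ∷ [] ∷ []
    } , ≤-refl

  Q₀-isQuasiKernel : IsQuasiKernel (D n) Q₀
  Q₀-isQuasiKernel = record { independent = Q₀-independent ; absorbing = Q₀-absorbing }

  smallest⇒∣Q∣≤1+n*n : ∀ {Q} → IsSmallestQuasiKernel (D n) Q → ∣ Q ∣ ≤ suc (n * n)
  smallest⇒∣Q∣≤1+n*n (_ , minimal) =
    ≤-trans (minimal Q₀ Q₀-isQuasiKernel) (∣image∣≤ (index ∘ Q₀-vertex))

-- Estimating the distance of the ratio from ½.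

∣m⊖n∣≤o : ∀ {m n o} → m ≤ n + o → n ≤ m + o → ℤ.∣ m ⊖ n ∣ ≤ o
∣m⊖n∣≤o {m} {n} {o} m≤n+o n≤m+o with ≤-total m n
... | inj₁ m≤n = subst (_≤ o) (sym (ℤ.∣⊖∣-≤ m≤n)) (m≤n+o⇒m∸n≤o n m n≤m+o)
... | inj₂ n≤m = subst (_≤ o) (sym (trans (ℤ.∣m⊖n∣≡∣n⊖m∣ m n) (ℤ.∣⊖∣-≤ n≤m)))
                   (m≤n+o⇒m∸n≤o m n m≤n+o)

-- Unnormalised rationals keep the denominator d · 2 explicit, with no reduction by a gcd, so that
-- inequalities can be cross-multiplied.
∣c/d-½∣≃ : ∀ c d .{{_ : NonZero d}} →
           toℚᵘ ℚ.∣ + c ℚ./ d ℚ.- ½ ∣ ℚᵘ.≃ (ℚᵘ._/_ (+ ℤ.∣ c * 2 ⊖ d ∣) (d * 2) {{m*n≢0 d 2}})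
∣c/d-½∣≃ c d@(suc d-1) = begin
  toℚᵘ ℚ.∣ + c ℚ./ d ℚ.- ½ ∣                          ≈⟨ toℚᵘ-homo-∣-∣ (+ c ℚ./ d ℚ.- ½) ⟩
  ℚᵘ.∣ toℚᵘ (+ c ℚ./ d ℚ.- ½) ∣                       ≈⟨ ℚᵘ.∣-∣-cong (toℚᵘ-homo-+ (+ c ℚ./ d) (ℚ.- ½)) ⟩
  ℚᵘ.∣ toℚᵘ (+ c ℚ./ d) ℚᵘ.+ ℚᵘ.-½ ∣                  ≈⟨ ℚᵘ.∣-∣-cong (ℚᵘ.+-congˡ ℚᵘ.-½ (toℚᵘ-fromℚᵘ (mkℚᵘ (+ c) d-1))) ⟩
  ℚᵘ.∣ mkℚᵘ (+ c) d-1 ℚᵘ.+ ℚᵘ.-½ ∣                    ≡⟨ cong (λ x → mkℚᵘ (+ ℤ.∣ x ∣) _) numerator ⟩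
  mkℚᵘ (+ ℤ.∣ c * 2 ⊖ d ∣) _                          ∎
  where
  open import Relation.Binary.Reasoning.Setoid ℚᵘ.≃-setoid
  numerator : + c ℤ.* + 2 ℤ.+ -[1+ 0 ] ℤ.* + d ≡ c * 2 ⊖ d
  numerator = trans (cong₂ ℤ._+_ (sym (ℤ.pos-* c 2)) (ℤ.-1*i≡-i (+ d))) (ℤ.m-n≡m⊖n (c * 2) d)

-- The order is 2n² + 3n + 1, while 2c lies between 2n² and 2n² + 2.
∣2c-order∣≤3n+1 : ∀ n {c} → n * n ≤ c → c ≤ suc (n * n) →
                ℤ.∣ c * 2 ⊖ Digraph.order (D n) ∣ ≤ 3 * n + 1
∣2c-order∣≤3n+1 n {c} lower upper = ∣m⊖n∣≤o
  (begin
    c * 2                          ≤⟨ *-monoˡ-≤ 2 upper ⟩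
    suc (n * n) * 2                ≤⟨ m≤m+n _ (6 * n) ⟩
    suc (n * n) * 2 + 6 * n        ≡⟨ upper-identity n ⟩
    order + (3 * n + 1)            ∎)
  (begin
    order                          ≡⟨ lower-identity n ⟩
    n * n * 2 + (3 * n + 1)        ≤⟨ +-monoˡ-≤ (3 * n + 1) (*-monoˡ-≤ 2 lower) ⟩
    c * 2 + (3 * n + 1)            ∎)
  where
  open ≤-Reasoning
  order : ℕ
  order = Digraph.order (D n)

  upper-identity : ∀ n → suc (n * n) * 2 + 6 * n ≡ suc (2 * n) + suc (2 * n) * n + (3 * n + 1)
  upper-identity = solve-∀

  lower-identity : ∀ n → suc (2 * n) + suc (2 * n) * n ≡ n * n * 2 + (3 * n + 1)
  lower-identity = solve-∀

-- Cross-multiplied form of (3n + 1) / (2 · order) < 1 / n.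
[3n+1]n<2order : ∀ n → (3 * n + 1) * n < Digraph.order (D n) * 2
[3n+1]n<2order n = begin-strict
  (3 * n + 1) * n                              <⟨ m<m+n _ (s≤s z≤n) ⟩
  (3 * n + 1) * n + suc (1 + n * n + 5 * n)    ≡⟨ identity n ⟩
  Digraph.order (D n) * 2                      ∎
  where
  open ≤-Reasoning
  identity : ∀ n → (3 * n + 1) * n + suc (1 + n * n + 5 * n) ≡ (suc (2 * n) + suc (2 * n) * n) * 2
  identity = solve-∀

proposition2p1 : (Q : (n : ℕ) → .{{_ : NonZero n}} → VertexSet (D n)) →
    ((n : ℕ) → .{{_ : NonZero n}} → IsSmallestQuasiKernel (D n) (Q n)) →
    ConvergesTo (λ n → ratio n (Q n)) ½
proposition2p1 Q smallest (mkℚ (+ zero)  q-1 _) (ℚ.*<* (+<+ ()))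
proposition2p1 Q smallest (mkℚ -[1+ _ ]  q-1 _) (ℚ.*<* ())
-- The threshold is the denominator of ε: its numerator is at least 1, so n ≥ `suc q-1` gives 1/n ≤
-- ε.
proposition2p1 Q smallest (mkℚ (+ suc p) q-1 _) _ = suc q-1 , close
  where
  close : ∀ n → .{{_ : NonZero n}} → suc q-1 ≤ n → ℚ.∣ ratio n (Q n) ℚ.- ½ ∣ ℚ.< _
  close n q≤n = toℚᵘ-cancel-< (ℚᵘ.<-respˡ-≃ (ℚᵘ.≃-sym (∣c/d-½∣≃ ∣ Q n ∣ order))
    (ℚᵘ.*<* (subst₂ ℤ._<_ (ℤ.pos-* deviation (suc q-1)) (ℤ.pos-* (suc p) (order * 2)) (+<+ bound))))
    where
    order : ℕ
    order = Digraph.order (D n)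

    deviation : ℕ
    deviation = ℤ.∣ ∣ Q n ∣ * 2 ⊖ order ∣

    open ≤-Reasoning
    bound : deviation * suc q-1 < suc p * (order * 2)
    bound = begin-strict
      deviation * suc q-1   ≤⟨ *-mono-≤ (∣2c-order∣≤3n+1 n (n*n≤∣Q∣ n (proj₁ (smallest n)))
                                           (smallest⇒∣Q∣≤1+n*n n (smallest n))) q≤n ⟩
      (3 * n + 1) * n       <⟨ [3n+1]n<2order n ⟩
      order * 2             ≤⟨ m≤n*m (order * 2) (suc p) ⟩
      suc p * (order * 2)   ∎
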